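{- Let $k\ge 1$ be an integer. It can be decided whether a given regular set $X\subseteq A^*$ satisfies any of the conditions (c1), (c2), (c4) (each taken individually, as defined in the context) with respect to $\mathcal{F}_k$.
   Context: $A$ is a finite alphabet with $|A|\ge 2$; $A^*$ is the free monoid over $A$ and $|w|$ is the length of $w$. A subset of $A^*$ is regular if it is recognized by a finite automaton; in decidability statements a regular set is given by a finite automaton. A set $X\subseteq A^*$ is a code if for all words $x_1,\dots,x_n,y_1,\dots,y_p\in X$, $x_1\cdots x_n=y_1\cdots y_p$ implies $n=p$ and $x_i=y_i$ for every $i$. For a relation $\tau\subseteq A^*\times A^*$ and $X\subseteq A^*$, $\tau(X)=\{y:\exists x\in X,\ (x,y)\in\tau\}$ and $\tau(x)=\tau(\{x\})$; $\widehat{\tau}=\tau\cup\{(w,w):w\in A^*\}$ and $\underline{\tau}=\tau\setminus\{(w,w):w\in A^*\}$. $X$ is $\tau$-independent if $\tau(X)\cap X=\emptyset$. $(w,w')\in\mathcal{F}_k$ iff $|w|+|w'|-2|f|\le k$, where $f$ is a maximum length common factor (contiguous subword) of $w$ and $w'$. Conditions on $X$ with respect to $\tau=\mathcal{F}_k$: (c1) $X$ is $\underline{\tau}$-independent. (c2) For all $x,y\in X$, $\tau(x)\cap\tau(y)\neq\emptyset$ implies $x=y$. (c4) $\widehat{\tau}(X)$ is a code. -}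

module Defs where

open import Data.Fin.Base using (Fin)
open import Data.Fin.Subset as Subset using (Subset)
open import Data.List.Base using (List; []; _∷_; length; concat)
open import Data.List.Relation.Binary.Infix.Heterogeneous using (Infix)
open import Data.List.Relation.Unary.All using (All)
open import Data.Nat.Base using (ℕ; _+_; _*_; _∸_; _≤_)
open import Data.Product.Base using (Σ-syntax; ∃-syntax; _×_)
open import Data.Sum.Base using (_⊎_)
open import Level using (0ℓ)
open import Relation.Binary.Core using (Rel)
open import Relation.Binary.PropositionalEquality.Core using (_≡_; _≢_)
open import Relation.Unary using (Pred; _∈_; _∩_; _≐_; ｛_｝; Empty; Satisfiable)

module _ (A : Set) where

  Word : Set
  Word = List A

  Language : Set₁
  Language = Pred Word 0ℓ

  WordRel : Set₁
  WordRel = Rel Word 0ℓ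

  record NFA : Set where
    field
      states  : ℕ
      initial : Subset states
      final   : Subset states
      δ       : Fin states → A → Subset states

module _ {A : Set} where

  module _ (M : NFA A) where
    open NFA M

    data AcceptsFrom (q : Fin states) : Word A → Set where
      stop : q Subset.∈ final → AcceptsFrom q []
      step : ∀ {a w} q′ → q′ Subset.∈ δ q a → AcceptsFrom q′ w → AcceptsFrom q (a ∷ w)

    ⟦_⟧ : Language A
    ⟦_⟧ w = ∃[ q ] q Subset.∈ initial × AcceptsFrom q w

  -- A regular set comes with an automaton recognizing it, so a decision
  -- for every regular set is an algorithm taking that automaton as input.
  Regular : Language A → Set
  Regular X = Σ[ M ∈ NFA A ] X ≐ ⟦ M ⟧

  Code : Language A → Set
  Code X = ∀ (xs ys : List (Word A)) → All X xs → All X ys →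
           concat xs ≡ concat ys → xs ≡ ys

  Image : WordRel A → Language A → Language A
  Image τ X y = ∃[ x ] x ∈ X × τ x y

  Reflexive-hat : WordRel A → WordRel A
  Reflexive-hat τ x y = τ x y ⊎ x ≡ y

  Irreflexive-part : WordRel A → WordRel A
  Irreflexive-part τ x y = τ x y × x ≢ y

  Independent : WordRel A → Language A → Set
  Independent τ X = Empty (Image τ X ∩ X)

  CommonFactor : Word A → Word A → Word A → Set
  CommonFactor w w′ f = Infix _≡_ f w × Infix _≡_ f w′

  MaxCommonFactor : Word A → Word A → Word A → Set
  MaxCommonFactor w w′ f =
    CommonFactor w w′ f × (∀ g → CommonFactor w w′ g → length g ≤ length f)

  -- The subtraction never truncates: a common factor is no longer than w or w′.
  𝓕 : ℕ → WordRel A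
  𝓕 k w w′ = ∃[ f ] MaxCommonFactor w w′ f × (length w + length w′) ∸ 2 * length f ≤ k

  C1 : WordRel A → Language A → Set
  C1 τ X = Independent (Irreflexive-part τ) X

  C2 : WordRel A → Language A → Set
  C2 τ X = ∀ x y → x ∈ X → y ∈ X →
           Satisfiable (Image τ ｛ x ｝ ∩ Image τ ｛ y ｝) → x ≡ y

  C4 : WordRel A → Language A → Set
  C4 τ X = Code (Image (Reflexive-hat τ) X)

{-# OPTIONS --safe #-}
-- Two facts carry the proof.  First, |w| + |w′| − 2|f| is a metric in which two
-- words at distance ≤ k + k have a common neighbour at distance ≤ k from both,
-- so C2 for 𝓕 k amounts to C1 for 𝓕 (k + k).
-- Second, a set of words that is a union of classes of a left-compatible
-- relation of finite index can be tested for emptiness, since by the pigeonhole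
-- principle a long member can be shortened.
--   C1: two words at distance ≤ n are a h b and c h d for one of finitely many
--       (a , b , c , d), and the h making them distinct members of X form such
--       a set.
--   C4: the image of X is such a set Y, and so is the set of words carrying
--       two different factorizations over Y, marked on the letters.
module Submission where

open import Defs
open import Data.Bool.Base using (Bool; true; false)
open import Data.Fin.Base using (Fin; zero; suc; toℕ; combine)
open import Data.Fin.Properties using (pigeonhole; combine-injective; toℕ<n; any?)
import Data.Fin.Properties as Fin
import Data.Fin.Subset as Subset
open import Data.Fin.Subset.Properties using (_∈?_)
open import Data.List.Base using
  (List; []; _∷_; [_]; _++_; length; concat; map; take; drop; foldr; upTo; allFin;
   cartesianProduct; cartesianProductWith)
open import Data.List.Membership.Propositional using (find; lose) renaming (_∈_ to _∈ˡ_)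
open import Data.List.Membership.Propositional.Properties using
  (∈-map⁺; ∈-allFin; ∈-upTo⁺; ∈-cartesianProduct⁺; ∈-cartesianProductWith⁺)
open import Data.List.Properties using
  (≡-dec; ∷-injective; ∷-injectiveʳ; length-++; ∷ʳ-++; length-take; length-drop; take++drop≡id)
open import Data.List.Relation.Binary.Infix.Heterogeneous using (Infix; here; there; MkView; toView; fromView)
import Data.List.Relation.Binary.Infix.Heterogeneous.Properties as Infix
open import Data.List.Relation.Binary.Pointwise using (Pointwise-≡⇒≡; ≡⇒Pointwise-≡)
open import Data.List.Relation.Binary.Prefix.Heterogeneous using (Prefix; []; _∷_)
import Data.List.Relation.Binary.Prefix.Heterogeneous.Properties as Prefix
open import Data.List.Relation.Unary.All as All using (All; []; _∷_)
open import Data.List.Relation.Unary.Any as Any using (here; there)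
open import Data.Nat.Base using (ℕ; zero; suc; _+_; _*_; _∸_; _≤_; _<_; z≤n; s≤s; s≤s⁻¹)
open import Data.Nat.Properties using
  (≤-refl; ≤-trans; ≤-reflexive; <-≤-trans; <-irrefl; <⇒≤; n≤1+n; m≤m+n; m≤n+m; ≮⇒≥; ≰⇒≥; ≰⇒>; _≤?_; _<?_;
   m≤n⇒m⊓n≡m; m∸n≤m; m∸n+n≡m; m+n≤o⇒m≤o∸n; m≤n+o⇒m∸n≤o; m≤n+m∸n;
   +-comm; +-assoc; +-suc; +-mono-≤; +-monoˡ-≤; +-monoʳ-≤; +-monoʳ-<; *-monoʳ-≤;
   +-cancelˡ-≤; +-cancelʳ-≤; module ≤-Reasoning)
open import Data.Nat.Tactic.RingSolver using (solve-∀)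
open import Data.Product.Base using (Σ-syntax; ∃; ∃-syntax; ∃₂; _×_; _,_; proj₁; proj₂)
import Data.Product.Properties as Product
open import Data.Sum.Base using (inj₁; inj₂)
open import Function.Base using (_∘_; _on_; id)
open import Function.Bundles using (_↔_; Inverse)
open import Level using (0ℓ)
open import Relation.Binary.Core using (Rel)
open import Relation.Binary.Definitions using (DecidableEquality)
open import Relation.Binary.PropositionalEquality using
  (_≡_; _≢_; refl; sym; trans; cong; cong₂; subst; subst₂)
open import Relation.Nullary using (¬_; yes; no; contradiction)
open import Relation.Nullary.Decidable using (map′; ¬?; _×-dec_; _⊎-dec_; decidable-stable)
open import Relation.Nullary.Decidable.Core using (Dec)
open import Relation.Unary using (Pred; Decidable; _≐_)

private
  variable
    A B I J : Set

-- Exhaustive search over finite lists and bounded words.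

search : (is : List I) {P : I → Set} → (∀ i → Dec (P i)) → (∀ {i} → P i → i ∈ˡ is) → Dec (∃ P)
search is P? bound =
  map′ (λ p → let i , _ , Pi = find p in i , Pi) (λ (_ , Pi) → lose (bound Pi) Pi) (Any.any? P? is)

module _ (letters : List B) (complete : ∀ b → b ∈ˡ letters) where

  words≤ : ℕ → List (List B)
  words≤ zero    = [ [] ]
  words≤ (suc n) = [] ∷ cartesianProductWith _∷_ letters (words≤ n)

  ∈-words≤ : ∀ n {w} → length w ≤ n → w ∈ˡ words≤ n
  ∈-words≤ zero    {[]}    _         = here refl
  ∈-words≤ (suc n) {[]}    _         = here refl
  ∈-words≤ (suc n) {b ∷ w} (s≤s w≤n) =
    there (∈-cartesianProductWith⁺ _∷_ (complete b) (∈-words≤ n w≤n))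

-- Relations of finite index

-- `R` need not be an equivalence: it only has to contain the kernel of a map to a finite set. Hence
-- one-sided relations such as `P u → P v` qualify.
FiniteIndex : Rel I 0ℓ → Set
FiniteIndex {I} R = ∃[ n ] Σ[ f ∈ (I → Fin n) ] (∀ {u v} → f u ≡ f v → R u v)

index-⊆ : {R S : Rel I 0ℓ} → (∀ {u v} → R u v → S u v) → FiniteIndex R → FiniteIndex S
index-⊆ R⊆S (n , f , f⇒R) = n , f , R⊆S ∘ f⇒R

index-on : {R : Rel I 0ℓ} (g : J → I) → FiniteIndex R → FiniteIndex (R on g)
index-on g (n , f , f⇒R) = n , f ∘ g , f⇒R

index-× : {R S : Rel I 0ℓ} → FiniteIndex R → FiniteIndex S → FiniteIndex (λ u v → R u v × S u v)
index-× (m , f , f⇒R) (n , g , g⇒S) = m * n , (λ u → combine (f u) (g u)) , λ {u} {v} fg≡ →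
  let f≡ , g≡ = combine-injective (f u) (g u) (f v) (g v) fg≡ in f⇒R f≡ , g⇒S g≡

index-→ : {P : I → Set} → Decidable P → FiniteIndex (λ u v → P u → P v)
index-→ {I} {P} P? = 2 , f , λ {u} {v} → f⇒→ u v
  where
  f : I → Fin 2
  f u with P? u
  ... | yes _ = suc zero
  ... | no  _ = zero

  f⇒→ : ∀ u v → f u ≡ f v → P u → P v
  f⇒→ u v f≡ Pu with P? u | P? v | f≡
  ... | _      | yes Pv | _  = Pv
  ... | no ¬Pu | no _   | _  = contradiction Pu ¬Pu
  ... | yes _  | no _   | ()

index-∀ : (js : List J) {R : J → Rel I 0ℓ} → (∀ j → FiniteIndex (R j)) →
          FiniteIndex (λ u v → ∀ {j} → j ∈ˡ js → R j u v)
index-∀ []       index = 1 , (λ _ → zero) , λ _ ()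
index-∀ (j ∷ js) index = index-⊆
  (λ { (r , rs) (here refl) → r ; (r , rs) (there j∈js) → rs j∈js })
  (index-× (index j) (index-∀ js index))

-- The relation is directed: u ≼ v says that v may replace u.
record Recognizable (P : Pred (List B) 0ℓ) : Set₁ where
  infix 4 _≼_
  field
    _≼_    : Rel (List B) 0ℓ
    index  : FiniteIndex _≼_
    ≼-∷    : ∀ b {u v} → u ≼ v → b ∷ u ≼ b ∷ v
    ≼-resp : ∀ {u v} → u ≼ v → P u → P v
    P?     : Decidable P

  ≼-refl : ∀ {u} → u ≼ u
  ≼-refl = proj₂ (proj₂ index) refl

  ≼-++ : ∀ w {u v} → u ≼ v → w ++ u ≼ w ++ v
  ≼-++ []      u≼v = u≼v
  ≼-++ (b ∷ w) u≼v = ≼-∷ b (≼-++ w u≼v)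

recognizable-≐ : {P Q : Pred (List B) 0ℓ} → P ≐ Q → Recognizable Q → Recognizable P
recognizable-≐ (P⊆Q , Q⊆P) rec = record
  { _≼_    = _≼_
  ; index  = index
  ; ≼-∷    = ≼-∷
  ; ≼-resp = λ u≼v → Q⊆P ∘ ≼-resp u≼v ∘ P⊆Q
  ; P?     = λ w → map′ Q⊆P P⊆Q (P? w)
  }
  where open Recognizable rec

-- Pumping and the emptiness test.

module _ {P : Pred (List B) 0ℓ} (rec : Recognizable P) where
  open Recognizable rec

  private
    bound : ℕ
    bound = proj₁ index

    class : List B → Fin bound
    class = proj₁ (proj₂ index)

  -- Among the `bound + 1` suffixes `drop i w` with `i ≤ bound`, two share a class. The longer one
  -- is replaced by the shorter one; suffixes are used because `_≼_` is compatible with letters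
  -- added on the left.
  pump : ∀ w → bound < length w → P w → ∃[ w′ ] P w′ × length w′ < length w
  pump w n<w Pw
    with i , j , i<j , same ← pigeonhole (≤-refl {suc bound}) (λ i → class (drop (toℕ i) w)) =
    take (toℕ i) w ++ drop (toℕ j) w ,
    ≼-resp (≼-++ (take (toℕ i) w) (proj₂ (proj₂ index) same))
           (subst P (sym (take++drop≡id (toℕ i) w)) Pw) ,
    shorter
    where
    j≤w : toℕ j ≤ length w
    j≤w = ≤-trans (s≤s⁻¹ (toℕ<n j)) (<⇒≤ n<w)

    open ≤-Reasoning
    shorter : length (take (toℕ i) w ++ drop (toℕ j) w) < length w
    shorter = begin-strict
      length (take (toℕ i) w ++ drop (toℕ j) w)         ≡⟨ length-++ (take (toℕ i) w) ⟩
      length (take (toℕ i) w) + length (drop (toℕ j) w)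
        ≡⟨ cong₂ _+_ (trans (length-take (toℕ i) w) (m≤n⇒m⊓n≡m (≤-trans (<⇒≤ i<j) j≤w)))
                     (length-drop (toℕ j) w) ⟩
      toℕ i + (length w ∸ toℕ j)                        ≡⟨ +-comm (toℕ i) _ ⟩
      (length w ∸ toℕ j) + toℕ i                        <⟨ +-monoʳ-< (length w ∸ toℕ j) i<j ⟩
      (length w ∸ toℕ j) + toℕ j                        ≡⟨ m∸n+n≡m j≤w ⟩
      length w                                          ∎

  shorten : ∀ m {w} → length w ≤ m → P w → ∃[ w′ ] P w′ × length w′ ≤ bound
  shorten m {w} w≤m Pw with length w ≤? bound
  ... | yes w≤n = w , Pw , w≤n
  shorten zero    w≤m Pw | no w≰n = contradiction (≤-trans w≤m z≤n) w≰n
  shorten (suc m) w≤m Pw | no w≰n =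
    let w′ , Pw′ , w′<w = pump _ (≰⇒> w≰n) Pw in shorten m (s≤s⁻¹ (≤-trans w′<w w≤m)) Pw′

  satisfiable? : (letters : List B) → (∀ b → b ∈ˡ letters) → Dec (∃ P)
  satisfiable? letters complete =
    map′ (λ (w , Pw , _) → w , Pw)
         (λ (w , Pw) → shorten (length w) ≤-refl Pw)
         (search (words≤ letters complete bound)
                 (λ w → P? w ×-dec (length w ≤? bound))
                 (λ (_ , w≤n) → ∈-words≤ letters complete bound w≤n))

-- Codes

module _ (letters : List A) (complete : ∀ a → a ∈ˡ letters) (_≟_ : DecidableEquality A)
         {Y : Language A} (Y-rec : Recognizable Y) where
  open Recognizable Y-rec

  -- Read from right to left, a marked letter is the first letter of a factor;
  -- the first component is the factor whose first letter has not been reached.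
  Pieces : Set
  Pieces = Word A × List (Word A)

  cut : Bool → A → Pieces → Pieces
  cut false a (u , us) = a ∷ u , us
  cut true  a (u , us) = [] , (a ∷ u) ∷ us

  cut-injective : ∀ b a {p q} → cut b a p ≡ cut b a q → p ≡ q
  cut-injective false a refl = refl
  cut-injective true  a refl = refl

  -- With equal marks `cut` is injective, so distinctness passes down and up again. With different
  -- marks the results always differ, one pending factor being empty and the other not.
  cut-≢ : ∀ b c a {p q r s} → (p ≢ q → r ≢ s) → cut b a p ≢ cut c a q → cut b a r ≢ cut c a s
  cut-≢ false false a p≢q⇒ ≢ = p≢q⇒ (≢ ∘ cong (cut false a)) ∘ cut-injective false a
  cut-≢ true  true  a p≢q⇒ ≢ = p≢q⇒ (≢ ∘ cong (cut true a)) ∘ cut-injective true a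
  cut-≢ false true  a _ _ ()
  cut-≢ true  false a _ _ ()

  Marked : Set
  Marked = A × Bool × Bool

  pieces : (Bool × Bool → Bool) → List Marked → Pieces
  pieces π = foldr (λ (a , marks) → cut (π marks) a) ([] , [])

  Complete : Pieces → Set
  Complete (u , us) = u ≡ [] × All Y us

  infix 4 _⊑_
  -- The finite information that survives further cuts: the class of the pending factor, whether it
  -- is empty, and whether all finished factors lie in `Y`.
  _⊑_ : Rel Pieces 0ℓ
  (u , us) ⊑ (v , vs) = u ≼ v × (u ≡ [] → v ≡ []) × (All Y us → All Y vs)

  empty? : (u : Word A) → Dec (u ≡ [])
  empty? []      = yes refl
  empty? (_ ∷ _) = no λ()

  ⊑-index : FiniteIndex _⊑_
  ⊑-index = index-× (index-on proj₁ index)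
    (index-× (index-on proj₁ (index-→ empty?)) (index-on proj₂ (index-→ (All.all? P?))))

  ⊑-cut : ∀ b a {p q} → p ⊑ q → cut b a p ⊑ cut b a q
  ⊑-cut false a (u≼v , _ , all) = ≼-∷ a u≼v , (λ ()) , all
  -- The cut finishes `a ∷ u`, whose membership in `Y` transfers along `≼-∷`; afterwards both
  -- pending factors are `[]`.
  ⊑-cut true  a (u≼v , _ , all) =
    ≼-refl , id , λ { (Yu ∷ Yus) → ≼-resp (≼-∷ a u≼v) Yu ∷ all Yus }

  Ambiguous : List Marked → Set
  Ambiguous v = Complete (pieces proj₁ v) × Complete (pieces proj₂ v) × pieces proj₁ v ≢ pieces proj₂ v

  _≟ᵖ_ : DecidableEquality Pieces
  _≟ᵖ_ = Product.≡-dec (≡-dec _≟_) (≡-dec (≡-dec _≟_))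

  complete? : Decidable Complete
  complete? (u , us) = empty? u ×-dec All.all? P? us

  distinct? : Decidable (λ v → pieces proj₁ v ≢ pieces proj₂ v)
  distinct? v = ¬? (pieces proj₁ v ≟ᵖ pieces proj₂ v)

  ambiguous-recognizable : Recognizable Ambiguous
  ambiguous-recognizable = record
    { _≼_    = λ v w → (pieces proj₁ v ⊑ pieces proj₁ w) × (pieces proj₂ v ⊑ pieces proj₂ w) ×
                       (pieces proj₁ v ≢ pieces proj₂ v → pieces proj₁ w ≢ pieces proj₂ w)
    ; index  = index-× (index-on (pieces proj₁) ⊑-index)
                 (index-× (index-on (pieces proj₂) ⊑-index) (index-→ distinct?))
    ; ≼-∷    = λ (a , b , c) (l , r , ≢) → ⊑-cut b a l , ⊑-cut c a r , cut-≢ b c a ≢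
    ; ≼-resp = λ ((_ , e , all) , (_ , e′ , all′) , ≢) ((eu , aus) , (eu′ , aus′) , d) →
                 (e eu , all aus) , (e′ eu′ , all′ aus′) , ≢ d
    ; P?     = λ v → complete? (pieces proj₁ v) ×-dec complete? (pieces proj₂ v) ×-dec distinct? v
    }

  NonEmpty : Word A → Set
  NonEmpty w = w ≢ []

  flatten : Pieces → Word A
  flatten (u , us) = u ++ concat us

  flatten-cut : ∀ b a p → flatten (cut b a p) ≡ a ∷ flatten p
  flatten-cut false a p = refl
  flatten-cut true  a p = refl

  -- The mark is forced: a nonempty pending factor gives `false`, otherwise `a` starts the first
  -- finished factor. Nonemptiness of the factors excludes a start without a letter.
  uncut : ∀ {a w} p → All NonEmpty (proj₂ p) → flatten p ≡ a ∷ w →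
          ∃₂ λ b q → cut b a q ≡ p × flatten q ≡ w × All NonEmpty (proj₂ q)
  uncut (_ ∷ u , us)        ne       refl = false , (u , us) , refl , refl , ne
  uncut ([] , [] ∷ us)      (n ∷ ne) _    = contradiction refl n
  uncut ([] , (_ ∷ u) ∷ us) (n ∷ ne) refl = true , (u , us) , refl , refl , ne

  flatten-[] : ∀ p → All NonEmpty (proj₂ p) → flatten p ≡ [] → p ≡ ([] , [])
  flatten-[] ([] , [])     _        _ = refl
  flatten-[] ([] , [] ∷ _) (n ∷ ne) _ = contradiction refl n

  -- Both sides spell `w`, so they can be uncut in step, one letter of `w` at a time, and the two
  -- marks found are stored on that letter.
  superpose : ∀ w p q → All NonEmpty (proj₂ p) → All NonEmpty (proj₂ q) →
              flatten p ≡ w → flatten q ≡ w →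
              ∃[ v ] pieces proj₁ v ≡ p × pieces proj₂ v ≡ q
  superpose []      p q ne ne′ p≡ q≡ = [] , sym (flatten-[] p ne p≡) , sym (flatten-[] q ne′ q≡)
  superpose (a ∷ w) p q ne ne′ p≡ q≡
    with b , p′ , refl , p′≡ , ne₁ ← uncut p ne p≡
       | c , q′ , refl , q′≡ , ne₂ ← uncut q ne′ q≡
    with v , refl , refl ← superpose w p′ q′ ne₁ ne₂ p′≡ q′≡
    = (a , b , c) ∷ v , refl , refl

  flatten-pieces : ∀ π v → flatten (pieces π v) ≡ map proj₁ v
  flatten-pieces π []                = refl
  flatten-pieces π ((a , marks) ∷ v) =
    trans (flatten-cut (π marks) a (pieces π v)) (cong (a ∷_) (flatten-pieces π v))

  -- Both tracks spell `map proj₁ v`, so a code would force equal factor lists, and the pending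
  -- factors are both empty.
  ambiguous⇒¬code : ∃ Ambiguous → ¬ Code Y
  ambiguous⇒¬code (v , (e , all) , (e′ , all′) , ≢) code =
    ≢ (cong₂ _,_ (trans e (sym e′)) (code _ _ all all′ (trans (sym (spell proj₁ e)) (spell proj₂ e′))))
    where
    spell : ∀ π → proj₁ (pieces π v) ≡ [] → map proj₁ v ≡ concat (proj₂ (pieces π v))
    spell π e = trans (sym (flatten-pieces π v)) (cong (_++ concat (proj₂ (pieces π v))) e)

  code? : Dec (Code Y)
  code? with P? []
  -- If the empty word lies in `Y`, it has the factorizations `[]` and `[ [] ]`. Otherwise all
  -- factors are nonempty, as `superpose` requires.
  ... | yes Y[] = no λ code → contradiction (code [] [ [] ] [] (Y[] ∷ []) refl) λ()
  ... | no ¬Y[] with satisfiable? ambiguous-recognizable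
                       (cartesianProduct letters (cartesianProduct bools bools))
                       (λ (a , b , c) → ∈-cartesianProduct⁺ (complete a) (∈-cartesianProduct⁺ (∈-bools b) (∈-bools c)))
    where
    bools : List Bool
    bools = true ∷ false ∷ []

    ∈-bools : ∀ b → b ∈ˡ bools
    ∈-bools true  = here refl
    ∈-bools false = there (here refl)
  ...   | yes ambiguous  = no (ambiguous⇒¬code ambiguous)
  ...   | no ¬ambiguous = yes code
    where
    nonEmpty : ∀ {us} → All Y us → All NonEmpty us
    nonEmpty = All.map λ { Yu refl → ¬Y[] Yu }

    code : Code Y
    code xs ys Yxs Yys same = decidable-stable (≡-dec (≡-dec _≟_) xs ys) λ xs≢ys →
      let v , l , r = superpose (concat xs) ([] , xs) ([] , ys) (nonEmpty Yxs) (nonEmpty Yys) refl (sym same)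
      in ¬ambiguous (v , subst Complete (sym l) (refl , Yxs) , subst Complete (sym r) (refl , Yys) ,
                     λ l≡r → xs≢ys (cong proj₂ (trans (sym l) (trans l≡r r))))

-- The factor metric

-- `𝓕 n` without truncated subtraction and without maximality: any common factor long enough is a
-- witness.
Close : ℕ → WordRel A
Close n x y = ∃[ f ] CommonFactor x y f × length x + length y ≤ n + 2 * length f

infix-refl : (x : Word A) → Infix _≡_ x x
infix-refl x = Infix.fromPointwise (≡⇒Pointwise-≡ refl)

infix-trans : {x y z : Word A} → Infix _≡_ x y → Infix _≡_ y z → Infix _≡_ x z
infix-trans = Infix.trans trans

prefix-overlap : {f g z : Word A} → Prefix _≡_ f z → Prefix _≡_ g z →
                 ∃[ h ] Prefix _≡_ h f × Prefix _≡_ h g × length f + length g ≤ length z + length h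
prefix-overlap {f = f} {g} {z} [] q = [] , [] , [] ,
  ≤-trans (Prefix.length-mono q) (m≤m+n (length z) 0)
prefix-overlap {f = f} {z = z} p@(_ ∷ _) [] = [] , [] , [] , +-monoˡ-≤ 0 (Prefix.length-mono p)
prefix-overlap {f = _ ∷ f} {_ ∷ g} {_ ∷ z} (refl ∷ p) (refl ∷ q) =
  let h , hf , hg , le = prefix-overlap p q in
  _ ∷ h , refl ∷ hf , refl ∷ hg ,
  s≤s (subst₂ _≤_ (sym (+-suc (length f) (length g))) (sym (+-suc (length z) (length h))) (s≤s le))

prefix-infix-overlap : {f g z : Word A} → Prefix _≡_ f z → Infix _≡_ g z →
                       ∃[ h ] CommonFactor f g h × length f + length g ≤ length z + length h
prefix-infix-overlap p (here q) =
  let h , hf , hg , le = prefix-overlap p q in h , (here hf , here hg) , le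
prefix-infix-overlap {z = z} [] q = [] , (here [] , here []) ,
  ≤-trans (Infix.length-mono q) (m≤m+n (length z) 0)
prefix-infix-overlap (_ ∷ p) (there q) =
  let h , (hf , hg) , le = prefix-infix-overlap p q in h , (there hf , hg) , s≤s le

-- Occurrences of `f` and `g` in `z` cover at most `length z` positions together, so they share at
-- least the excess; `h` is the shared part, or `[]`.
infix-overlap : {f g z : Word A} → Infix _≡_ f z → Infix _≡_ g z →
                ∃[ h ] CommonFactor f g h × length f + length g ≤ length z + length h
infix-overlap (here p) q = prefix-infix-overlap p q
infix-overlap {f = f} {g} (there p) (here q) =
  let h , (hg , hf) , le = prefix-infix-overlap q (there p) in
  h , (hf , hg) , ≤-trans (≤-reflexive (+-comm (length f) (length g))) le
infix-overlap (there p) (there q) =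
  let h , common , le = infix-overlap p q in h , common , ≤-trans le (n≤1+n _)

close-sym : ∀ {n} {x y : Word A} → Close n x y → Close n y x
close-sym {x = x} {y} (f , (fx , fy) , le) =
  f , (fy , fx) , ≤-trans (≤-reflexive (+-comm (length y) (length x))) le

-- Triangle inequality: the overlap inside `z` of the two common factors is a common factor of `x`
-- and `y`. Adding the two bounds and cancelling twice the length of `z` gives the estimate.
close-trans : ∀ {m n} {x y z : Word A} → Close m x z → Close n z y → Close (m + n) x y
close-trans {m = m} {n} {x} {y} {z} (f , (fx , fz) , le) (g , (gz , gy) , le′) =
  let h , (hf , hg) , fg≤ = infix-overlap fz gz in
  h , (infix-trans hf fx , infix-trans hg gy) ,
  sum (length x) (length y) (length z) (length f) (length g) (length h) le le′ fg≤
  where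
  open ≤-Reasoning
  sum : ∀ x y z f g h → x + z ≤ m + 2 * f → z + y ≤ n + 2 * g → f + g ≤ z + h →
        x + y ≤ m + n + 2 * h
  sum x y z f g h le le′ fg≤ = +-cancelʳ-≤ (2 * z) _ _ (begin
    x + y + 2 * z               ≡⟨ lemma₁ x y z ⟩
    (x + z) + (z + y)           ≤⟨ +-mono-≤ le le′ ⟩
    (m + 2 * f) + (n + 2 * g)   ≡⟨ lemma₂ m n f g ⟩
    m + n + 2 * (f + g)         ≤⟨ +-monoʳ-≤ (m + n) (*-monoʳ-≤ 2 fg≤) ⟩
    m + n + 2 * (z + h)         ≡⟨ lemma₃ m n z h ⟩
    m + n + 2 * h + 2 * z       ∎)
    where
    lemma₁ : ∀ x y z → x + y + 2 * z ≡ (x + z) + (z + y)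
    lemma₁ = solve-∀
    lemma₂ : ∀ m n f g → (m + 2 * f) + (n + 2 * g) ≡ m + n + 2 * (f + g)
    lemma₂ = solve-∀
    lemma₃ : ∀ m n z h → m + n + 2 * (z + h) ≡ m + n + 2 * h + 2 * z
    lemma₃ = solve-∀

-- Intermediate words between two close words.

prefix-interpolate : ∀ k {f x : Word A} → Prefix _≡_ f x → length f ≤ k → k ≤ length x →
                     ∃[ z ] Prefix _≡_ f z × Prefix _≡_ z x × length z ≡ k
prefix-interpolate zero    []         _   _     = [] , [] , [] , refl
prefix-interpolate (suc k) {x = a ∷ _} [] _ (s≤s k≤x) =
  let z , _ , zx , ≡k = prefix-interpolate k [] z≤n k≤x in a ∷ z , [] , refl ∷ zx , cong suc ≡k
prefix-interpolate (suc k) {x = a ∷ _} (refl ∷ p) (s≤s f≤k) (s≤s k≤x) =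
  let z , fz , zx , ≡k = prefix-interpolate k p f≤k k≤x in a ∷ z , refl ∷ fz , refl ∷ zx , cong suc ≡k

-- Letters of `x` are dropped on the left as long as they precede `f`; what remains of `m` is
-- dropped on the right.
interpolate : ∀ m {f x : Word A} → Infix _≡_ f x → length f + m ≤ length x →
              ∃[ z ] Infix _≡_ f z × Infix _≡_ z x × length z + m ≡ length x
interpolate m {f} {x} (here p) le =
  let z , fz , zx , ≡k = prefix-interpolate (length x ∸ m) p (m+n≤o⇒m≤o∸n (length f) le) (m∸n≤m _ m)
  in z , here fz , here zx , trans (cong (_+ m) ≡k) (m∸n+n≡m (≤-trans (m≤n+m m (length f)) le))
interpolate zero    {x = x} p _  = x , p , infix-refl x , +-comm (length x) 0
interpolate (suc m) {f} {_ ∷ x} (there p) le =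
  let z , fz , zx , ≡k = interpolate m p (s≤s⁻¹ (≤-trans (≤-reflexive (sym (+-suc (length f) m))) le))
  in z , fz , there zx , trans (+-suc (length z) m) (cong suc ≡k)

-- There is room to drop `m` letters of `x` outside `f`. The result `z` uses up exactly `m`, and
-- since it still contains `f`, the remaining `n` suffices to reach `y`.
between-far : ∀ m n {x y : Word A} f → CommonFactor x y f → length x + length y ≤ m + n + 2 * length f →
              length f + m ≤ length x → ∃[ z ] Close m x z × Close n z y
between-far m n {x} {y} f (fx , fy) le f+m≤x with interpolate m fx f+m≤x
... | z , fz , zx , z+m≡x =
  z , (z , (zx , infix-refl z) , ≤-reflexive (trans (cong (_+ length z) (sym z+m≡x)) (lemma₁ m (length z)))) ,
  (f , (fz , fy) , +-cancelˡ-≤ m _ _ (begin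
    m + (length z + length y) ≡⟨ lemma₂ m (length z) (length y) ⟩
    length z + m + length y   ≡⟨ cong (_+ length y) z+m≡x ⟩
    length x + length y       ≤⟨ le ⟩
    m + n + 2 * length f      ≡⟨ +-assoc m n _ ⟩
    m + (n + 2 * length f)    ∎))
  where
  open ≤-Reasoning
  lemma₁ : ∀ m z → z + m + z ≡ m + 2 * z
  lemma₁ = solve-∀
  lemma₂ : ∀ m z y → m + (z + y) ≡ z + m + y
  lemma₂ = solve-∀

-- Letters are dropped from `x`, or symmetrically from `y`, if enough of them lie outside `f`. If
-- neither has enough, `f` itself is within `m` of `x` and within `n` of `y`.
between : ∀ m n {x y : Word A} → Close (m + n) x y → ∃[ z ] Close m x z × Close n z y
between m n {x} {y} (f , common@(fx , fy) , le)
  with length f + m ≤? length x | length f + n ≤? length y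
... | yes f+m≤x | _ = between-far m n f common le f+m≤x
... | no _ | yes f+n≤y =
  let z , yz , zx = between-far n m f (fy , fx)
                      (subst₂ _≤_ (+-comm (length x) (length y)) (cong (_+ 2 * length f) (+-comm m n)) le)
                      f+n≤y
  in z , close-sym {n = m} zx , close-sym {n = n} yz
... | no f+m≰x | no f+n≰y =
  f , (f , (fx , infix-refl f) , ≤-trans (+-monoˡ-≤ (length f) (≰⇒≥ f+m≰x)) (≤-reflexive (lemma m (length f)))) ,
  (f , (infix-refl f , fy) ,
   ≤-trans (+-monoʳ-≤ (length f) (≰⇒≥ f+n≰y)) (≤-reflexive (trans (+-comm (length f) _) (lemma n (length f)))))
  where
  lemma : ∀ m f → f + m + f ≡ m + 2 * f
  lemma = solve-∀

𝓕⇒close : ∀ {n} {x y : Word A} → 𝓕 n x y → Close n x y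
𝓕⇒close {n = n} {x} {y} (f , (common , _) , le) = f , common , (begin
  length x + length y                                       ≤⟨ m≤n+m∸n _ (2 * length f) ⟩
  2 * length f + ((length x + length y) ∸ 2 * length f)     ≤⟨ +-monoʳ-≤ (2 * length f) le ⟩
  2 * length f + n                                          ≡⟨ +-comm (2 * length f) n ⟩
  n + 2 * length f                                          ∎)
  where open ≤-Reasoning

-- Existence of maximum length common factors.

module _ (letters : List A) (complete : ∀ a → a ∈ˡ letters) (_≟_ : DecidableEquality A) where

  -- As long as a longer common factor exists, it replaces `f`. The fuel bounds the number of
  -- replacements, since no common factor is longer than `x`.
  maxCommonFactor : ∀ fuel {x y : Word A} f → CommonFactor x y f → length x ≤ length f + fuel →
                    ∃[ g ] MaxCommonFactor x y g × length f ≤ length g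
  maxCommonFactor fuel {x} {y} f common x≤
    with search (words≤ letters complete (length x))
                (λ g → (Infix.infix? _≟_ g x ×-dec Infix.infix? _≟_ g y) ×-dec (length f <? length g))
                (λ ((gx , _) , _) → ∈-words≤ letters complete _ (Infix.length-mono gx))
  ... | no ¬longer = f , (common , λ g common′ → ≮⇒≥ λ f<g → ¬longer (g , common′ , f<g)) , ≤-refl
  maxCommonFactor zero {x} f common x≤ | yes (g , (gx , _) , f<g) =
    contradiction (<-≤-trans f<g (≤-trans (Infix.length-mono gx) (subst (length x ≤_) (+-comm _ 0) x≤)))
                  (<-irrefl refl)
  maxCommonFactor (suc fuel) {x} f common x≤ | yes (g , common′ , f<g) =
    let h , max , g≤h = maxCommonFactor fuel g common′
                          (≤-trans x≤ (subst (_≤ length g + fuel) (sym (+-suc (length f) fuel)) (+-monoˡ-≤ fuel f<g)))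
    in h , max , ≤-trans (<⇒≤ f<g) g≤h

  close⇒𝓕 : ∀ {n} {x y : Word A} → Close n x y → 𝓕 n x y
  close⇒𝓕 {n} {x} {y} (f , common , le) =
    let g , max , f≤g = maxCommonFactor (length x) f common (m≤n+m (length x) (length f)) in
    g , max , m≤n+o⇒m∸n≤o (length x + length y) (2 * length g)
      (≤-trans le (≤-trans (+-monoʳ-≤ n (*-monoʳ-≤ 2 f≤g)) (≤-reflexive (+-comm n (2 * length g)))))

-- Regular languages

module _ (letters : List A) (complete : ∀ a → a ∈ˡ letters) (_≟_ : DecidableEquality A) (M : NFA A) where
  open NFA M

  accepts? : ∀ q w → Dec (AcceptsFrom M q w)
  accepts? q []      = map′ stop (λ { (stop q∈final) → q∈final }) (q ∈? final)
  accepts? q (a ∷ w) = map′ (λ (q′ , q→q′ , acc) → step q′ q→q′ acc)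
                            (λ { (step q′ q→q′ acc) → q′ , q→q′ , acc })
                            (any? λ q′ → (q′ ∈? δ q a) ×-dec accepts? q′ w)

  member? : Decidable ⟦ M ⟧
  member? w = any? λ q → (q ∈? initial) ×-dec accepts? q w

  infix 4 _⊴_
  -- Inclusion of the sets of states from which the words are accepted; there are finitely many such
  -- sets.
  _⊴_ : Rel (Word A) 0ℓ
  u ⊴ v = ∀ q → AcceptsFrom M q u → AcceptsFrom M q v

  ⊴-index : FiniteIndex _⊴_
  ⊴-index = index-⊆ (λ r q → r (∈-allFin q))
                    (index-∀ (allFin states) (λ q → index-→ (accepts? q)))

  ⊴-++ : ∀ w {u v} → u ⊴ v → w ++ u ⊴ w ++ v
  ⊴-++ []      u⊴v q acc               = u⊴v q acc
  ⊴-++ (a ∷ w) u⊴v q (step q′ q→q′ acc) = step q′ q→q′ (⊴-++ w u⊴v q′ acc)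

  ⊴-resp : ∀ {u v} → u ⊴ v → ⟦ M ⟧ u → ⟦ M ⟧ v
  ⊴-resp u⊴v (q , q∈initial , acc) = q , q∈initial , u⊴v q acc

  -- Pairs of distinct members at bounded distance.

  -- Whether a h b = c h d depends, letter by letter in h, only on the bounded
  -- word by which one side is ahead of the other; quantifying over all bounded
  -- left contexts makes this a left-compatible relation of finite index.
  Lag : ℕ → Word A → Word A → Rel (Word A) 0ℓ
  Lag n b d u v = ∀ a c → length a ≤ n → length c ≤ n →
                  a ++ v ++ b ≡ c ++ v ++ d → a ++ u ++ b ≡ c ++ u ++ d

  lag-index : ∀ n b d → FiniteIndex (Lag n b d)
  lag-index n b d = index-⊆
    -- `index-→` is applied to the inequality; its contrapositive, by decidable equality, is the
    -- implication from `v` to `u`.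
    (λ {u} {v} r a c a≤n c≤n v≡ → decidable-stable (≡-dec _≟_ (a ++ u ++ b) (c ++ u ++ d))
      λ u≢ → r {a} (∈-words n a≤n) {c} (∈-words n c≤n) u≢ v≡)
    (index-∀ (words n) λ a → index-∀ (words n) λ c →
      index-→ λ u → ¬? (≡-dec _≟_ (a ++ u ++ b) (c ++ u ++ d)))
    where
    words   = words≤ letters complete
    ∈-words = ∈-words≤ letters complete

  -- Stripping the common first letter leaves shorter contexts if both are nonempty. If only one is,
  -- `x` moves from the middle word to its end, which restores its length, so the bound `n`
  -- persists.
  lag-∷ : ∀ n b d x {u v} → Lag n b d u v → Lag n b d (x ∷ u) (x ∷ v)
  lag-∷ n b d x {u} {v} lag = go
    where
    snoc-≤ : ∀ {k} (w : Word A) → suc (length w) ≤ k → length (w ++ [ x ]) ≤ k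
    snoc-≤ w = subst (_≤ _) (sym (trans (length-++ w) (+-comm (length w) 1)))

    go : ∀ a c → length a ≤ n → length c ≤ n →
         a ++ x ∷ v ++ b ≡ c ++ x ∷ v ++ d → a ++ x ∷ u ++ b ≡ c ++ x ∷ u ++ d
    go [] [] _ _ v≡ = cong (x ∷_) (lag [] [] z≤n z≤n (∷-injectiveʳ v≡))
    go [] (y ∷ c) _ c≤n v≡ with refl , v≡′ ← ∷-injective v≡ =
      cong (x ∷_) (trans (lag [] (c ++ [ x ]) z≤n (snoc-≤ c c≤n)
                                (trans v≡′ (sym (∷ʳ-++ c x (v ++ d)))))
                         (∷ʳ-++ c x (u ++ d)))
    go (y ∷ a) [] a≤n _ v≡ with refl , v≡′ ← ∷-injective v≡ =
      cong (x ∷_) (trans (sym (∷ʳ-++ a x (u ++ b)))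
                         (lag (a ++ [ x ]) [] (snoc-≤ a a≤n) z≤n
                              (trans (∷ʳ-++ a x (v ++ b)) v≡′)))
    go (y ∷ a) (z ∷ c) a≤n c≤n v≡ with refl , v≡′ ← ∷-injective v≡ =
      cong (y ∷_) (go a c (<⇒≤ a≤n) (<⇒≤ c≤n) v≡′)

  Context : Set
  Context = Word A × Word A × Word A × Word A

  Separates : Context → Language A
  Separates (a , b , c , d) h =
    ⟦ M ⟧ (a ++ h ++ b) × ⟦ M ⟧ (c ++ h ++ d) × a ++ h ++ b ≢ c ++ h ++ d

  separates-recognizable : ∀ κ → Recognizable (Separates κ)
  separates-recognizable (a , b , c , d) = record
    { _≼_    = λ u v → (u ++ b ⊴ v ++ b) × (u ++ d ⊴ v ++ d) × Lag n b d u v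
    ; index  = index-× (index-on (_++ b) ⊴-index)
                 (index-× (index-on (_++ d) ⊴-index) (lag-index n b d))
    ; ≼-∷    = λ x {u} {v} (l , r , lag) → ⊴-++ [ x ] l , ⊴-++ [ x ] r , lag-∷ n b d x {u} {v} lag
    ; ≼-resp = λ (l , r , lag) (L , R , ≢) →
                 ⊴-resp (⊴-++ a l) L , ⊴-resp (⊴-++ c r) R ,
                 ≢ ∘ lag a c (m≤m+n (length a) (length c)) (m≤n+m (length c) (length a))
    ; P?     = λ h → member? (a ++ h ++ b) ×-dec member? (c ++ h ++ d) ×-dec
                     ¬? (≡-dec _≟_ (a ++ h ++ b) (c ++ h ++ d))
    }
    -- Large enough for `lag` to apply to the outer contexts `a` and `c` themselves.
    where n = length a + length c

  ClosePair : ℕ → Set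
  ClosePair n = ∃₂ λ x y → ⟦ M ⟧ x × ⟦ M ⟧ y × x ≢ y × Close n x y

  -- With common factor `h`, the words `a h b` and `c h d` differ by the total length of the
  -- context. So only contexts of size at most `n` matter, and their four components have length at
  -- most `n`.
  closePair? : ∀ n → Dec (ClosePair n)
  closePair? n = map′ to from
    (search (cartesianProduct words (cartesianProduct words (cartesianProduct words words)))
            (λ κ → (size κ ≤? n) ×-dec satisfiable? (separates-recognizable κ) letters complete)
            (λ { {a , b , c , d} (le , _) →
              let ab≤ = ≤-trans (m≤m+n (length a + length b) _) le
                  cd≤ = ≤-trans (m≤n+m (length c + length d) (length a + length b)) le
              in ∈-cartesianProduct⁺ (∈-words (≤-trans (m≤m+n _ _) ab≤))
                 (∈-cartesianProduct⁺ (∈-words (≤-trans (m≤n+m (length b) _) ab≤))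
                 (∈-cartesianProduct⁺ (∈-words (≤-trans (m≤m+n _ _) cd≤))
                                      (∈-words (≤-trans (m≤n+m (length d) _) cd≤)))) }))
    where
    words : List (Word A)
    words = words≤ letters complete n

    ∈-words : ∀ {w} → length w ≤ n → w ∈ˡ words
    ∈-words = ∈-words≤ letters complete n

    size : Context → ℕ
    size (a , b , c , d) = (length a + length b) + (length c + length d)

    length-around : ∀ (a h b c d : Word A) → length (a ++ h ++ b) + length (c ++ h ++ d) ≡
                    size (a , b , c , d) + 2 * length h
    length-around a h b c d = trans (cong₂ _+_ (length-++₃ a b) (length-++₃ c d))
                                    (lemma (length a) (length b) (length c) (length d) (length h))
      where
      length-++₃ : ∀ u v → length (u ++ h ++ v) ≡ length u + (length h + length v)
      length-++₃ u v = trans (length-++ u) (cong (length u +_) (length-++ h))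

      lemma : ∀ a b c d h → (a + (h + b)) + (c + (h + d)) ≡ ((a + b) + (c + d)) + 2 * h
      lemma = solve-∀

    to : (∃[ κ ] size κ ≤ n × ∃ (Separates κ)) → ClosePair n
    to ((a , b , c , d) , le , h , x∈ , y∈ , x≢y) = a ++ h ++ b , c ++ h ++ d , x∈ , y∈ , x≢y ,
      h , (fromView (MkView a (≡⇒Pointwise-≡ refl) b) , fromView (MkView c (≡⇒Pointwise-≡ refl) d)) ,
      ≤-trans (≤-reflexive (length-around a h b c d)) (+-monoˡ-≤ (2 * length h) le)

    from : ClosePair n → ∃[ κ ] size κ ≤ n × ∃ (Separates κ)
    from (x , y , x∈ , y∈ , x≢y , h , (hx , hy) , le)
      with MkView a h≋ b ← toView hx | MkView c h≋′ d ← toView hy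
      with refl ← Pointwise-≡⇒≡ h≋ | refl ← Pointwise-≡⇒≡ h≋′ =
      (a , b , c , d) ,
      +-cancelʳ-≤ (2 * length h) _ _ (≤-trans (≤-reflexive (sym (length-around a h b c d))) le) ,
      h , x∈ , y∈ , x≢y

  -- Neighbourhoods of a regular language.

  data Phase : Set where
    before inside after : Phase

  -- Near p n q w: w arises from a word x accepted from q by deleting and
  -- inserting n letters at most, all outside a common factor; p is the position
  -- relative to that factor.
  data Near : Phase → ℕ → Fin states → Word A → Set where
    insertˡ : ∀ {n q a w} → Near before n q w → Near before (suc n) q (a ∷ w)
    deleteˡ : ∀ {n q a w} q′ → q′ Subset.∈ δ q a → Near before n q′ w → Near before (suc n) q w
    enter   : ∀ {n q w} → Near inside n q w → Near before n q w
    copy    : ∀ {n q a w} q′ → q′ Subset.∈ δ q a → Near inside n q′ w → Near inside n q (a ∷ w)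
    leave   : ∀ {n q w} → Near after n q w → Near inside n q w
    insertʳ : ∀ {n q a w} → Near after n q w → Near after (suc n) q (a ∷ w)
    deleteʳ : ∀ {n q a w} q′ → q′ Subset.∈ δ q a → Near after n q′ w → Near after (suc n) q w
    halt    : ∀ {n q} → q Subset.∈ final → Near after n q []

  letter? : {P : A → Set} → (∀ a → Dec (P a)) → Dec (∃ P)
  letter? P? = search letters P? (λ {a} _ → complete a)

  -- Recursion on `n`: a deletion leaves `w` unchanged but spends one unit of the budget.
  after? : ∀ n q w → Dec (Near after n q w)
  after? zero q [] = map′ halt (λ { (halt q∈final) → q∈final }) (q ∈? final)
  after? zero q (a ∷ w) = no λ ()
  after? (suc n) q [] =
    map′ (λ { (inj₁ q∈final) → halt q∈final ; (inj₂ (a , q′ , q→q′ , near)) → deleteʳ q′ q→q′ near })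
         (λ { (halt q∈final) → inj₁ q∈final ; (deleteʳ q′ q→q′ near) → inj₂ (_ , q′ , q→q′ , near) })
         ((q ∈? final) ⊎-dec letter? λ a → any? λ q′ → (q′ ∈? δ q a) ×-dec after? n q′ [])
  after? (suc n) q (b ∷ w) =
    map′ (λ { (inj₁ near) → insertʳ near ; (inj₂ (a , q′ , q→q′ , near)) → deleteʳ q′ q→q′ near })
         (λ { (insertʳ near) → inj₁ near ; (deleteʳ q′ q→q′ near) → inj₂ (_ , q′ , q→q′ , near) })
         (after? n q w ⊎-dec letter? λ a → any? λ q′ → (q′ ∈? δ q a) ×-dec after? n q′ (b ∷ w))

  inside? : ∀ n q w → Dec (Near inside n q w)
  inside? n q []      = map′ leave (λ { (leave near) → near }) (after? n q [])
  inside? n q (a ∷ w) =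
    map′ (λ { (inj₁ near) → leave near ; (inj₂ (q′ , q→q′ , near)) → copy q′ q→q′ near })
         (λ { (leave near) → inj₁ near ; (copy q′ q→q′ near) → inj₂ (q′ , q→q′ , near) })
         (after? n q (a ∷ w) ⊎-dec any? λ q′ → (q′ ∈? δ q a) ×-dec inside? n q′ w)

  before? : ∀ n q w → Dec (Near before n q w)
  before? zero    q w  = map′ enter (λ { (enter near) → near }) (inside? zero q w)
  before? (suc n) q [] =
    map′ (λ { (inj₁ near) → enter near ; (inj₂ (a , q′ , q→q′ , near)) → deleteˡ q′ q→q′ near })
         (λ { (enter near) → inj₁ near ; (deleteˡ q′ q→q′ near) → inj₂ (_ , q′ , q→q′ , near) })
         (inside? (suc n) q [] ⊎-dec letter? λ a → any? λ q′ → (q′ ∈? δ q a) ×-dec before? n q′ [])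
  before? (suc n) q (b ∷ w) =
    map′ (λ { (inj₁ near)                             → enter near
            ; (inj₂ (inj₁ near))                      → insertˡ near
            ; (inj₂ (inj₂ (a , q′ , q→q′ , near)))    → deleteˡ q′ q→q′ near })
         (λ { (enter near)              → inj₁ near
            ; (insertˡ near)            → inj₂ (inj₁ near)
            ; (deleteˡ q′ q→q′ near)    → inj₂ (inj₂ (_ , q′ , q→q′ , near)) })
         (inside? (suc n) q (b ∷ w) ⊎-dec before? n q w ⊎-dec
          letter? λ a → any? λ q′ → (q′ ∈? δ q a) ×-dec before? n q′ (b ∷ w))

  near? : ∀ p n q w → Dec (Near p n q w)
  near? before = before?
  near? inside = inside?
  near? after  = after?

  -- All phases, states and smaller budgets are included because consuming a letter may change the
  -- state and lower the budget, in any phase.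
  _[_]⊴_ : Word A → ℕ → Word A → Set
  u [ k ]⊴ v = ∀ p n → n ≤ k → ∀ q → Near p n q u → Near p n q v

  near-index : ∀ k → FiniteIndex (_[ k ]⊴_)
  near-index k = index-⊆ (λ r p n n≤k q → r (∈-phases p) (∈-upTo⁺ (s≤s n≤k)) (∈-allFin q))
    (index-∀ phases λ p → index-∀ (upTo (suc k)) λ n → index-∀ (allFin states) λ q → index-→ (near? p n q))
    where
    phases : List Phase
    phases = before ∷ inside ∷ after ∷ []

    ∈-phases : ∀ p → p ∈ˡ phases
    ∈-phases before = here refl
    ∈-phases inside = there (here refl)
    ∈-phases after  = there (there (here refl))

  -- Induction on the derivation: deletions and phase changes keep the leading `a`, and the first
  -- rule that consumes it reduces to the hypothesis on `u` and `v`.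
  near-∷ : ∀ k a {u v} → u [ k ]⊴ v → (a ∷ u) [ k ]⊴ (a ∷ v)
  near-∷ k a r _ _ n≤k q (insertˡ near)         = insertˡ (r before _ (<⇒≤ n≤k) q near)
  near-∷ k a r _ _ n≤k q (deleteˡ q′ q→q′ near) = deleteˡ q′ q→q′ (near-∷ k a r before _ (<⇒≤ n≤k) q′ near)
  near-∷ k a r _ _ n≤k q (enter near)           = enter (near-∷ k a r inside _ n≤k q near)
  near-∷ k a r _ _ n≤k q (copy q′ q→q′ near)    = copy q′ q→q′ (r inside _ n≤k q′ near)
  near-∷ k a r _ _ n≤k q (leave near)           = leave (near-∷ k a r after _ n≤k q near)
  near-∷ k a r _ _ n≤k q (insertʳ near)         = insertʳ (r after _ (<⇒≤ n≤k) q near)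
  near-∷ k a r _ _ n≤k q (deleteʳ q′ q→q′ near) = deleteʳ q′ q→q′ (near-∷ k a r after _ (<⇒≤ n≤k) q′ near)

  Neighbourhood : ℕ → Language A
  Neighbourhood k w = ∃[ q ] q Subset.∈ initial × Near before k q w

  neighbourhood-recognizable : ∀ k → Recognizable (Neighbourhood k)
  neighbourhood-recognizable k = record
    { _≼_    = _[ k ]⊴_
    ; index  = near-index k
    ; ≼-∷    = near-∷ k
    ; ≼-resp = λ r (q , q∈initial , near) → q , q∈initial , r before k ≤-refl q near
    ; P?     = λ w → any? λ q → (q ∈? initial) ×-dec before? k q w
    }

  after⇒ : ∀ {n q y} → Near after n q y → ∃[ x ] AcceptsFrom M q x × length x + length y ≤ n
  after⇒ (insertʳ near) =
    let x , acc , le = after⇒ near in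
    x , acc , ≤-trans (≤-reflexive (+-suc (length x) _)) (s≤s le)
  after⇒ (deleteʳ q′ q→q′ near) =
    let x , acc , le = after⇒ near in _ ∷ x , step q′ q→q′ acc , s≤s le
  after⇒ (halt q∈final) = [] , stop q∈final , z≤n


  after⇐ : ∀ n {q} x y → AcceptsFrom M q x → length x + length y ≤ n → Near after n q y
  after⇐ zero    []      []      (stop q∈final)        _        = halt q∈final
  after⇐ (suc n) []      []      (stop q∈final)        _        = halt q∈final
  after⇐ (suc n) []      (_ ∷ y) acc                   (s≤s le) = insertʳ (after⇐ n [] y acc le)
  after⇐ (suc n) (_ ∷ x) y       (step q′ q→q′ acc)    (s≤s le) = deleteʳ q′ q→q′ (after⇐ n x y acc le)

  private
    suc+suc : ∀ x y → suc x + suc y ≡ 2 + (x + y)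
    suc+suc x y = cong suc (+-suc x y)

    n+2*suc : ∀ n f → n + 2 * suc f ≡ 2 + (n + 2 * f)
    n+2*suc = solve-∀

  -- Each copied letter lengthens `x`, `y` and `f` by one, so both sides of the bound grow by two.
  inside⇒ : ∀ {n q y} → Near inside n q y →
            ∃₂ λ x f → AcceptsFrom M q x × Prefix _≡_ f x × Prefix _≡_ f y ×
                       length x + length y ≤ n + 2 * length f
  inside⇒ {n} (copy q′ q→q′ near) =
    let x , f , acc , fx , fy , le = inside⇒ near in
    _ ∷ x , _ ∷ f , step q′ q→q′ acc , refl ∷ fx , refl ∷ fy ,
    subst₂ _≤_ (sym (suc+suc (length x) _)) (sym (n+2*suc n (length f))) (s≤s (s≤s le))
  inside⇒ {n} (leave near) =
    let x , acc , le = after⇒ near in x , [] , acc , [] , [] , ≤-trans le (m≤m+n n 0)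

  inside⇐ : ∀ n {q f x y} → AcceptsFrom M q x → Prefix _≡_ f x → Prefix _≡_ f y →
            length x + length y ≤ n + 2 * length f → Near inside n q y
  inside⇐ n {x = x} {y} acc [] [] le = leave (after⇐ n x y acc (≤-trans le (≤-reflexive (+-comm n 0))))
  inside⇐ n {f = _ ∷ f} {_ ∷ x} {_ ∷ y} (step q′ q→q′ acc) (refl ∷ fx) (refl ∷ fy) le =
    copy q′ q→q′ (inside⇐ n acc fx fy
      (s≤s⁻¹ (s≤s⁻¹ (subst₂ _≤_ (suc+suc (length x) (length y)) (n+2*suc n (length f)) le))))

  before⇒ : ∀ {n q y} → Near before n q y → ∃[ x ] AcceptsFrom M q x × Close n x y
  before⇒ (insertˡ near) =
    let x , acc , f , (fx , fy) , le = before⇒ near in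
    x , acc , f , (fx , there fy) , ≤-trans (≤-reflexive (+-suc (length x) _)) (s≤s le)
  before⇒ (deleteˡ q′ q→q′ near) =
    let x , acc , f , (fx , fy) , le = before⇒ near in
    _ ∷ x , step q′ q→q′ acc , f , (there fx , fy) , s≤s le
  before⇒ (enter near) =
    let x , f , acc , fx , fy , le = inside⇒ near in x , acc , f , (here fx , here fy) , le

  factors-≤ : ∀ {f x y : Word A} → Infix _≡_ f x → Infix _≡_ f y → 2 * length f ≤ length x + length y
  factors-≤ {f} {x} {y} fx fy =
    +-mono-≤ (Infix.length-mono fx) (≤-trans (≤-reflexive (+-comm (length f) 0)) (Infix.length-mono fy))

  -- The letters of `x` ahead of `f` are deleted first, then those of `y` ahead of `f` are inserted.
  -- With budget zero there are none, as twice the length of `f` already accounts for both words.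
  before⇐ : ∀ n {q f x y} → AcceptsFrom M q x → Infix _≡_ f x → Infix _≡_ f y →
            length x + length y ≤ n + 2 * length f → Near before n q y
  before⇐ n acc (here fx) (here fy) le = enter (inside⇐ n acc fx fy le)
  before⇐ zero (step _ _ _) (there fx) fy le =
    contradiction (≤-trans le (factors-≤ fx fy)) (<-irrefl refl)
  before⇐ (suc n) (step q′ q→q′ acc) (there fx) fy le = deleteˡ q′ q→q′ (before⇐ n acc fx fy (s≤s⁻¹ le))
  before⇐ zero {x = x} {_ ∷ y} acc fx@(here _) (there fy) le =
    contradiction (≤-trans (≤-trans (≤-reflexive (sym (+-suc (length x) (length y)))) le) (factors-≤ fx fy))
                  (<-irrefl refl)
  before⇐ (suc n) {x = x} {_ ∷ y} acc fx@(here _) (there fy) le =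
    insertˡ (before⇐ n acc fx fy (s≤s⁻¹ (≤-trans (≤-reflexive (sym (+-suc (length x) (length y)))) le)))

  neighbourhood-close : ∀ k → Neighbourhood k ≐ Image (Close k) ⟦ M ⟧
  neighbourhood-close k =
    (λ (q , q∈initial , near) → let x , acc , close = before⇒ near in x , (q , q∈initial , acc) , close) ,
    (λ (x , (q , q∈initial , acc) , f , (fx , fy) , le) → q , q∈initial , before⇐ k acc fx fy le)

  image-recognizable : ∀ k {X : Language A} → X ≐ ⟦ M ⟧ → Recognizable (Image (Reflexive-hat (𝓕 k)) X)
  image-recognizable k {X} (X⊆M , M⊆X) =
    recognizable-≐ (from , to) (neighbourhood-recognizable k)
    where
    from : ∀ {y} → Image (Reflexive-hat (𝓕 k)) X y → Neighbourhood k y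
    from (x , Xx , inj₁ xFy)  = proj₂ (neighbourhood-close k) (x , X⊆M Xx , 𝓕⇒close xFy)
    -- Every word is at distance zero from itself, with itself as common factor, so the added
    -- identity pairs are already in the neighbourhood.
    from (x , Xx , inj₂ refl) = proj₂ (neighbourhood-close k)
      (x , X⊆M Xx , x , (infix-refl x , infix-refl x) ,
       ≤-trans (≤-reflexive (cong (length x +_) (+-comm 0 (length x)))) (m≤n+m (2 * length x) k))

    to : ∀ {y} → Neighbourhood k y → Image (Reflexive-hat (𝓕 k)) X y
    to near = let x , Mx , close = proj₁ (neighbourhood-close k) near in
      x , M⊆X Mx , inj₁ (close⇒𝓕 letters complete _≟_ close)

  -- Decisions for the three conditions.

  C1? : ∀ k {X : Language A} → X ≐ ⟦ M ⟧ → Dec (C1 (𝓕 k) X)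
  C1? k {X} (X⊆M , M⊆X) = map′ c1 pair (¬? (closePair? k))
    where
    c1 : ¬ ClosePair k → C1 (𝓕 k) X
    c1 ¬pair y ((x , Xx , xFy , x≢y) , Xy) = ¬pair (x , y , X⊆M Xx , X⊆M Xy , x≢y , 𝓕⇒close xFy)

    pair : C1 (𝓕 k) X → ¬ ClosePair k
    pair c1 (x , y , Mx , My , x≢y , close) =
      c1 y ((x , M⊆X Mx , close⇒𝓕 letters complete _≟_ close , x≢y) , M⊆X My)

  C2? : ∀ k {X : Language A} → X ≐ ⟦ M ⟧ → Dec (C2 (𝓕 k) X)
  C2? k {X} (X⊆M , M⊆X) = map′ c2 pair (¬? (closePair? (k + k)))
    where
    c2 : ¬ ClosePair (k + k) → C2 (𝓕 k) X
    c2 ¬pair x y Xx Xy (z , (_ , refl , xFz) , (_ , refl , yFz)) =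
      decidable-stable (≡-dec _≟_ x y) λ x≢y →
        ¬pair (x , y , X⊆M Xx , X⊆M Xy , x≢y ,
               close-trans {m = k} {k} (𝓕⇒close xFz) (close-sym {n = k} (𝓕⇒close yFz)))

    pair : C2 (𝓕 k) X → ¬ ClosePair (k + k)
    pair c2 (x , y , Mx , My , x≢y , close) =
      -- The budget `k + k` is split evenly, so that `z` is a common neighbour for `𝓕 k`.
      let z , xz , zy = between k k close in
      x≢y (c2 x y (M⊆X Mx) (M⊆X My)
        (z , (x , refl , close⇒𝓕 letters complete _≟_ xz) ,
             (y , refl , close⇒𝓕 letters complete _≟_ (close-sym {n = k} zy))))

  C4? : ∀ k {X : Language A} → X ≐ ⟦ M ⟧ → Dec (C4 (𝓕 k) X)
  C4? k X≐M = code? letters complete _≟_ (image-recognizable k X≐M)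

proposition5p2 : (A : Set) (m : ℕ) → A ↔ Fin m → 2 ≤ m →
    (k : ℕ) → 1 ≤ k →
    (X : Language A) → Regular X →
    Dec (C1 (𝓕 k) X) × Dec (C2 (𝓕 k) X) × Dec (C4 (𝓕 k) X)
proposition5p2 A m A↔Fin _ k _ X (M , X≐M) =
  C1? letters complete _≟_ M k X≐M , C2? letters complete _≟_ M k X≐M , C4? letters complete _≟_ M k X≐M
  where
  open Inverse A↔Fin

  letters : List A
  letters = map from (allFin m)

  complete : ∀ a → a ∈ˡ letters
  complete a = subst (_∈ˡ letters) (strictlyInverseʳ a) (∈-map⁺ from (∈-allFin (to a)))

  _≟_ : DecidableEquality A
  a ≟ b = map′ (λ to≡ → trans (sym (strictlyInverseʳ a)) (trans (cong from to≡) (strictlyInverseʳ b)))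
               (cong to) (to a Fin.≟ to b)
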